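{- Let $A,B,Y\subseteq\mathbb F_2^n$ with $A\ne\varnothing$ and $Y\subseteq B$, and let $H\le\mathbb F_2^n$ be a subspace. Suppose that $$|A+A|\le K|A|,\qquad |A\triangle B|\le\eta|A|\ \ (0\le\eta<1),\qquad |Y|\ge\gamma|B|\ \ (0<\gamma\le1),$$ $$|H|\le|Y|,\qquad \mathcal N_H(Y)\le P.$$ If $\Delta(\gamma,\eta)>0$, then from any basis of $H$ one can construct a subspace $V\le H$ such that $$|V|\le|A|\qquad\text{and}\qquad\mathcal N_V(A)\le\frac{2KP}{\Delta(\gamma,\eta)}.$$ The construction does not use $A$, $|A|$, or $\eta$.
   Context: For $S,T\subseteq\mathbb F_2^n$, $S+T=\{s+t:s\in S,t\in T\}$; $\triangle$ is symmetric difference. For a subspace $V$ and a set $S$, $\mathcal N_V(S)=\min\{|T|:S\subseteq T+V\}$ is the minimum number of $V$-cosets needed to cover $S$. For $\gamma\in[0,1]$ and $\eta\ge0$, $\Delta(\gamma,\eta):=\gamma-\max\{\gamma,1-\gamma\}\,\eta$. -}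

module Defs where

open import Algebra.Apartness.Structures using (IsHeytingField)
open import Algebra.Bundles using (CommutativeRing)
open import Algebra.Core using (Op₁; Op₂)
import Algebra.Definitions.RawMonoid as RawMonoidDefs
open import Data.List.Base
  using (List; []; _∷_; [_]; _++_; length; filter; deduplicate; cartesianProductWith)
open import Data.List.Membership.Propositional using (_∈_; find; lose)
import Data.List.Membership.DecPropositional as DecMembership
open import Data.List.Membership.Propositional.Properties
  using (∈-cartesianProductWith⁺; ∈-cartesianProductWith⁻; ∈-deduplicate⁺)
open import Data.List.Relation.Binary.Subset.Propositional using (_⊆_)
open import Data.List.Relation.Unary.All using (All; all?; lookup; tabulate)
open import Data.List.Relation.Unary.Any using (any?; here; there)
open import Data.List.Properties using (length-deduplicate)
open import Data.Nat.Base using (ℕ; zero; suc)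
import Data.Nat.Base as ℕ
import Data.Nat.Properties as ℕ
open import Data.Nat.Induction using (<-rec)
open import Data.Parity.Base using (Parity; 0ℙ; 1ℙ)
import Data.Parity.Base as ℙ
import Data.Parity.Properties as ℙ
open import Data.Product using (∃; _×_; _,_; proj₁; proj₂)
open import Data.Sum.Base using (_⊎_; inj₁; inj₂)
open import Data.Vec.Base using (Vec; []; _∷_; map; zipWith; replicate; foldr′)
import Data.Vec.Properties as Vec
open import Function.Bundles using (_⇔_)
import Level as L
open import Relation.Binary.Core using (Rel)
open import Relation.Binary.Definitions using (DecidableEquality)
open import Relation.Binary.Structures using (IsStrictPartialOrder)
open import Relation.Binary.Lattice.Structures using (IsJoinSemilattice)
open import Relation.Binary.PropositionalEquality using (_≡_; refl; subst; cong)
open import Relation.Nullary using (¬_; ¬?; Dec; yes; no)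
open import Relation.Nullary.Decidable using (map′)

------------------------------------------------------------------------
-- The field of scalars in which K, η, γ and P live.
--
-- The standard library has no real numbers, so the scalars range over an
-- arbitrary ordered field.  The axioms are the usual constructive ones:
-- apartness is "x < y or y < x" and x ≤ y is ¬ (y < x).  They hold for ℚ
-- and for the real numbers, classically as well as constructively.

record OrderedField (c ℓ₁ ℓ₂ : L.Level) : Set (L.suc (c L.⊔ ℓ₁ L.⊔ ℓ₂)) where
  infix  8 -_
  infixl 7 _*_ _/_⟨_⟩
  infixl 6 _+_ _⊔_
  infix  4 _≈_ _<_ _≤_ _#_
  field
    Carrier : Set c
    _≈_     : Rel Carrier ℓ₁
    _<_     : Rel Carrier ℓ₂
    _+_ _*_ : Op₂ Carrier
    -_      : Op₁ Carrier
    0# 1#   : Carrier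
    _⊔_     : Op₂ Carrier

  _≤_ : Rel Carrier ℓ₂
  x ≤ y = ¬ (y < x)

  _#_ : Rel Carrier ℓ₂
  x # y = x < y ⊎ y < x

  field
    isHeytingField       : IsHeytingField _≈_ _#_ _+_ _*_ -_ 0# 1#
    isStrictPartialOrder : IsStrictPartialOrder _≈_ _<_
    isJoinSemilattice    : IsJoinSemilattice _≈_ _≤_ _⊔_
    +-monoˡ-<            : ∀ {x y} z → x < y → x + z < y + z
    *-pos                : ∀ {x y} → 0# < x → 0# < y → 0# < x * y

  open IsHeytingField isHeytingField public
    using (isCommutativeRing; #⇒invertible; invertible⇒#; tight)

  commutativeRing : CommutativeRing c ℓ₁
  commutativeRing = record { isCommutativeRing = isCommutativeRing }

  open CommutativeRing commutativeRing public using (_-_; +-rawMonoid)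

  fromℕ : ℕ → Carrier
  fromℕ n = RawMonoidDefs._×_ +-rawMonoid n 1#

  -- #⇒invertible inverts y - 0#, which is ≈ y.
  _/_⟨_⟩ : ∀ (x y : Carrier) → 0# < y → Carrier
  x / y ⟨ 0<y ⟩ = x * proj₁ (#⇒invertible (inj₂ 0<y))

  Δ : Carrier → Carrier → Carrier
  Δ γ η = γ - (γ ⊔ (1# - γ)) * η

------------------------------------------------------------------------
-- The vector space 𝔽₂ⁿ; Parity is the field with two elements.

𝔽₂^_ : ℕ → Set
𝔽₂^ n = Vec Parity n

module _ {n : ℕ} where

  infixl 6 _⊕_
  infixr 7 _·_

  𝟎 : 𝔽₂^ n
  𝟎 = replicate n 0ℙ

  _⊕_ : 𝔽₂^ n → 𝔽₂^ n → 𝔽₂^ n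
  _⊕_ = zipWith ℙ._+_

  _·_ : Parity → 𝔽₂^ n → 𝔽₂^ n
  c · x = map (c ℙ.*_) x

  linearCombination : ∀ {d} → Vec Parity d → Vec (𝔽₂^ n) d → 𝔽₂^ n
  linearCombination c b = foldr′ _⊕_ 𝟎 (zipWith _·_ c b)

  _≟_ : DecidableEquality (𝔽₂^ n)
  _≟_ = Vec.≡-dec ℙ._≟_

------------------------------------------------------------------------
-- A subset of 𝔽₂ⁿ is given by listing its elements.  Order and repetitions
-- are irrelevant: only membership and the number of distinct entries are
-- ever used.

FinSet : ℕ → Set
FinSet n = List (𝔽₂^ n)

module _ {n : ℕ} where

  open DecMembership (_≟_ {n}) using (_∈?_)

  infixl 6 _⊹_ _△_

  ∣_∣ : FinSet n → ℕ
  ∣ S ∣ = length (deduplicate _≟_ S)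

  _⊹_ : FinSet n → FinSet n → FinSet n
  S ⊹ T = cartesianProductWith _⊕_ S T

  _△_ : FinSet n → FinSet n → FinSet n
  S △ T = filter (λ x → ¬? (x ∈? T)) S ++ filter (λ x → ¬? (x ∈? S)) T

record Subspace (n : ℕ) : Set where
  field
    elements : FinSet n
    𝟎-mem    : 𝟎 ∈ elements
    ⊕-closed : ∀ {x y} → x ∈ elements → y ∈ elements → x ⊕ y ∈ elements
    ·-closed : ∀ c {x} → x ∈ elements → c · x ∈ elements

open Subspace public using (elements)

record IsBasis {n d : ℕ} (H : Subspace n) (b : Vec (𝔽₂^ n) d) : Set where
  field
    spans       : ∀ x → x ∈ elements H ⇔ ∃ λ c → linearCombination c b ≡ x
    independent : ∀ c → linearCombination c b ≡ 𝟎 → c ≡ 𝟎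

------------------------------------------------------------------------
-- Covering by cosets

module _ {n : ℕ} (V : Subspace n) (S : FinSet n) where

  Covers : FinSet n → Set
  Covers T = S ⊆ T ⊹ elements V

  -- m = min { |T| : S ⊆ T + V }
  IsCoveringNumber : ℕ → Set
  IsCoveringNumber m =
    (∃ λ T → Covers T × ∣ T ∣ ≡ m) × (∀ T → Covers T → m ℕ.≤ ∣ T ∣)

private

  parities : List Parity
  parities = 0ℙ ∷ 1ℙ ∷ []

  ∈-parities : ∀ p → p ∈ parities
  ∈-parities 0ℙ = here refl
  ∈-parities 1ℙ = there (here refl)

  vectors : ∀ n → FinSet n
  vectors zero    = [ [] ]
  vectors (suc n) = cartesianProductWith _∷_ parities (vectors n)

  ∈-vectors : ∀ {n} (x : 𝔽₂^ n) → x ∈ vectors n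
  ∈-vectors []      = here refl
  ∈-vectors (p ∷ x) = ∈-cartesianProductWith⁺ _∷_ (∈-parities p) (∈-vectors x)

  lists : ∀ n → ℕ → List (FinSet n)
  lists n zero    = [ [] ]
  lists n (suc k) = cartesianProductWith _∷_ (vectors n) (lists n k)

  ∈-lists : ∀ {n} (T : FinSet n) → T ∈ lists n (length T)
  ∈-lists []      = here refl
  ∈-lists (x ∷ T) = ∈-cartesianProductWith⁺ _∷_ (∈-vectors x) (∈-lists T)

  length-lists : ∀ {n} k {T : FinSet n} → T ∈ lists n k → length T ≡ k
  length-lists zero (here refl) = refl
  length-lists {n} (suc k) T∈
    with _ , _ , _ , T′∈ , refl ← ∈-cartesianProductWith⁻ _∷_ (vectors n) (lists n k) T∈
    = cong suc (length-lists k T′∈)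

  least : ∀ {P : ℕ → Set} → (∀ m → Dec (P m)) → ∀ m → P m →
          ∃ λ k → P k × (∀ j → P j → k ℕ.≤ j)
  least {P} P? = <-rec _ λ m rec Pm → step m rec Pm (ℕ.anyUpTo? P? m)
    where
    step : ∀ m → (∀ {j} → j ℕ.< m → P j → ∃ λ k → P k × (∀ i → P i → k ℕ.≤ i)) →
           P m → Dec (∃ λ j → j ℕ.< m × P j) → ∃ λ k → P k × (∀ i → P i → k ℕ.≤ i)
    step m rec Pm (yes (j , j<m , Pj)) = rec j<m Pj
    step m rec Pm (no none) = m , Pm , λ i Pi → ℕ.≮⇒≥ λ i<m → none (i , i<m , Pi)

module _ {n : ℕ} (V : Subspace n) (S : FinSet n) where

  private

    open DecMembership (_≟_ {n}) using (_∈?_)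

    CoveredBy : ℕ → Set
    CoveredBy k = ∃ λ T → Covers V S T × length T ≡ k

    Covered : FinSet n → Set
    Covered T = All (_∈ T ⊹ elements V) S

    coveredBy? : ∀ k → Dec (CoveredBy k)
    coveredBy? k = map′
      (λ any → let T , T∈ , cov = find any in T , lookup cov , length-lists k T∈)
      (λ { (T , cov , refl) → lose {P = Covered} (∈-lists T) (tabulate cov) })
      (any? (λ T → all? (_∈? (T ⊹ elements V)) S) (lists n k))

    ⊕-𝟎 : ∀ {m} (x : 𝔽₂^ m) → x ⊕ 𝟎 ≡ x
    ⊕-𝟎 = Vec.zipWith-identityʳ ℙ.+-identityʳ

    covers-self : Covers V S S
    covers-self {x} x∈S = subst (_∈ S ⊹ elements V) (⊕-𝟎 x)
      (∈-cartesianProductWith⁺ _⊕_ x∈S (Subspace.𝟎-mem V))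

    covers-deduplicate : ∀ T → Covers V S T → Covers V S (deduplicate _≟_ T)
    covers-deduplicate T cov x∈S
      with _ , _ , t∈ , v∈ , refl ←
             ∈-cartesianProductWith⁻ _⊕_ T (elements V) (cov x∈S)
      = ∈-cartesianProductWith⁺ _⊕_ (∈-deduplicate⁺ _≟_ t∈) v∈

  coveringNumber : ∃ (IsCoveringNumber V S)
  coveringNumber
    with m , (T , cov , refl) , m-least ←
           least coveredBy? (length S) (S , covers-self , refl)
    = m
    , (T , cov , ℕ.≤-antisym (length-deduplicate _≟_ T) (lower T cov))
    , lower
    where
    lower : ∀ T′ → Covers V S T′ → m ℕ.≤ ∣ T′ ∣
    lower T′ cov′ = m-least ∣ T′ ∣ (deduplicate _≟_ T′ , covers-deduplicate T′ cov′ , refl)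

  𝒩 : ℕ
  𝒩 = proj₁ coveringNumber

{-# OPTIONS --safe #-}

-- V is the span of the given basis of H with its first vector dropped, so that
-- V has index at most 2 in H.  Since |H| ≤ |Y| ≤ |B| < 2|A|, this makes
-- |V| ≤ |A|.  For the covering number let N = 𝒩 H Y and X = A ∩ Y.  Some coset
-- of H meets X in a set Z with |X| ≤ N |Z|.  If R ⊆ A represents the cosets of
-- H that meet A, then the sums r + z with r ∈ R and z ∈ Z are distinct elements
-- of A + A, so |R| |Z| ≤ |A + A|; as A ⊆ R + H is covered by 2|R| cosets of V,
-- this gives 𝒩 V A · |X| ≤ 2 N |A + A|.  Finally |X| ≥ Δ(γ,η) |A|.

module Submission where

open import Defs
open import Algebra.Apartness.Bundles using (HeytingCommutativeRing)
import Algebra.Apartness.Properties.HeytingCommutativeRing as HeytingCommutativeRingProperties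
open import Algebra.Apartness.Structures using (IsHeytingField)
open import Algebra.Bundles using (AbelianGroup; CommutativeRing)
open import Data.List.Base
  using (List; []; _∷_; _++_; length; map; filter; deduplicate)
import Data.List.Membership.DecPropositional as DecMembership
open import Data.List.Membership.Propositional using (_∈_; _∉_)
open import Data.List.Membership.Propositional.Properties
  using ( ∈-cartesianProductWith⁺; ∈-cartesianProductWith⁻; ∈-deduplicate⁺
        ; ∈-deduplicate⁻; ∈-filter⁺; ∈-filter⁻; ∈-map⁻; ∈-++⁺ˡ; ∈-++⁺ʳ; ∈-++⁻; ∈-∃++)
open import Data.List.Properties
  using (length-++; length-map; length-++-sucʳ; length-deduplicate)
open import Data.List.Relation.Binary.Disjoint.Propositional using (Disjoint)
open import Data.List.Relation.Binary.Subset.Propositional using (_⊆_)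
import Data.List.Relation.Unary.All as All
open import Data.List.Relation.Unary.AllPairs using (AllPairs; []; _∷_)
open import Data.List.Relation.Unary.Any using (here; there)
open import Data.List.Relation.Unary.Unique.Propositional using (Unique)
import Data.List.Relation.Unary.Unique.Propositional.Properties as Unique
import Data.List.Relation.Unary.Unique.DecPropositional.Properties as UniqueDec
open import Data.Nat.Base using (ℕ; zero; suc) renaming (_≤_ to _≤ℕ_)
import Data.Nat.Base as ℕ
import Data.Nat.Properties as ℕ
open import Data.Parity.Base using (0ℙ; 1ℙ)
import Data.Parity.Properties as ℙ
open import Data.Product using (Σ; ∃; _×_; _,_; proj₁; proj₂)
open import Data.Sum.Base as Sum using (_⊎_; inj₁; inj₂; [_,_]′)
open import Data.Vec.Base using (Vec; []; _∷_)
import Data.Vec.Properties as Vec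
open import Function.Base using (_∘_; id)
open import Function.Bundles using (Equivalence)
open import Level using (Level)
open import Relation.Binary.Bundles using (Poset)
open import Relation.Binary.Lattice.Structures using (IsJoinSemilattice)
open import Relation.Binary.PropositionalEquality
  using (_≡_; _≢_; refl; sym; trans; cong; cong₂; subst; isEquivalence)
open import Relation.Binary.Structures using (IsPartialOrder; IsStrictPartialOrder)
open import Relation.Nullary using (¬_; ¬?; yes; no; contradiction)
open import Relation.Nullary.Decidable using (toSum)
open import Relation.Unary using (Pred; Decidable)

-- Vectors over 𝔽₂

module _ {n : ℕ} where

  ⊕-self : (x : 𝔽₂^ n) → x ⊕ x ≡ 𝟎
  ⊕-self x = trans (cong (_⊕ x) (sym (Vec.map-id x))) (Vec.zipWith-inverseˡ ℙ.p+p≡0ℙ x)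

  ⊕-abelianGroup : AbelianGroup _ _
  ⊕-abelianGroup = record
    { Carrier = 𝔽₂^ n ; _≈_ = _≡_ ; _∙_ = _⊕_ ; ε = 𝟎 ; _⁻¹ = id
    ; isAbelianGroup = record
      { isGroup = record
        { isMonoid = record
          { isSemigroup = record
            { isMagma = record
              { isEquivalence = isEquivalence
              ; ∙-cong = cong₂ _⊕_ }
            ; assoc = Vec.zipWith-assoc ℙ.+-assoc }
          ; identity = Vec.zipWith-identityˡ ℙ.+-identityˡ
                     , Vec.zipWith-identityʳ ℙ.+-identityʳ }
        ; inverse = ⊕-self , ⊕-self
        ; ⁻¹-cong = id }
      ; comm = Vec.zipWith-comm ℙ.+-comm } }

  open AbelianGroup ⊕-abelianGroup public using ()
    renaming ( assoc to ⊕-assoc; comm to ⊕-comm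
             ; identityˡ to ⊕-identityˡ; identityʳ to ⊕-identityʳ)
  open import Algebra.Properties.Group (AbelianGroup.group ⊕-abelianGroup) public using ()
    renaming (∙-cancelˡ to ⊕-cancelˡ; inverseˡ-unique to x⊕y≡𝟎⇒x≡y)
  open import Algebra.Properties.CommutativeSemigroup
    (AbelianGroup.commutativeSemigroup ⊕-abelianGroup) public using ()
    renaming (interchange to ⊕-interchange)

  -- In characteristic 2 the two sides of the hypothesis add up to `𝟎`, and this sum regroups as
  -- `(s ⊕ t) ⊕ (x ⊕ y)`.
  ⊕-exchange : ∀ {s t x y : 𝔽₂^ n} → s ⊕ x ≡ t ⊕ y → s ⊕ t ≡ x ⊕ y
  ⊕-exchange {s} {t} {x} {y} eq = x⊕y≡𝟎⇒x≡y _ _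
    (trans (⊕-interchange s t x y) (trans (cong (_⊕ (t ⊕ y)) eq) (⊕-self _)))

  x⊕[x⊕y]≡y : (x y : 𝔽₂^ n) → x ⊕ (x ⊕ y) ≡ y
  x⊕[x⊕y]≡y x y =
    trans (sym (⊕-assoc x x y)) (trans (cong (_⊕ y) (⊕-self x)) (⊕-identityˡ y))

  0·x≡𝟎 : (x : 𝔽₂^ n) → 0ℙ · x ≡ 𝟎
  0·x≡𝟎 x = Vec.map-const x 0ℙ

  1·x≡x : (x : 𝔽₂^ n) → 1ℙ · x ≡ x
  1·x≡x = Vec.map-id

-- Cardinalities of finite sets

-- Induction on `xs`: one occurrence of the head is deleted from `ys`. The tail still embeds in what
-- is left, because the head does not recur in it.
length-mono-⊆ : ∀ {a} {A : Set a} {xs ys : List A} →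
                Unique xs → xs ⊆ ys → length xs ≤ℕ length ys
length-mono-⊆ []                        xs⊆ys = ℕ.z≤n
length-mono-⊆ {xs = x ∷ xs} (x∉xs ∷ xs!) xs⊆ys
  with as , bs , refl ← ∈-∃++ (xs⊆ys (here refl))
  = subst (suc (length xs) ≤ℕ_) (sym (length-++-sucʳ as x bs)) (ℕ.s≤s (length-mono-⊆ xs! xs⊆as++bs))
  where
  xs⊆as++bs : xs ⊆ as ++ bs
  xs⊆as++bs z∈xs with ∈-++⁻ as (xs⊆ys (there z∈xs))
  ... | inj₁ z∈as         = ∈-++⁺ˡ z∈as
  ... | inj₂ (here refl)  = contradiction refl (All.lookup x∉xs z∈xs)
  ... | inj₂ (there z∈bs) = ∈-++⁺ʳ as z∈bs

module _ {n : ℕ} where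

  open DecMembership (_≟_ {n}) using (_∈?_)

  infixl 7 _∩_ _∖_

  _∩_ _∖_ : FinSet n → FinSet n → FinSet n
  S ∩ T = filter (_∈? T) S
  S ∖ T = filter (λ x → ¬? (x ∈? T)) S

  ⊆-deduplicate : (S : FinSet n) → S ⊆ deduplicate _≟_ S
  ⊆-deduplicate _ = ∈-deduplicate⁺ _≟_

  deduplicate-⊆ : (S : FinSet n) → deduplicate _≟_ S ⊆ S
  deduplicate-⊆ S = ∈-deduplicate⁻ _≟_ S

  deduplicate-! : (S : FinSet n) → Unique (deduplicate _≟_ S)
  deduplicate-! = UniqueDec.deduplicate-! _≟_

  ∣∣-unique : {S T : FinSet n} → Unique S → S ⊆ T → length S ≤ℕ ∣ T ∣
  ∣∣-unique {T = T} S! S⊆T = length-mono-⊆ S! (⊆-deduplicate T ∘ S⊆T)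

  ∣∣-mono : {S T : FinSet n} → S ⊆ T → ∣ S ∣ ≤ℕ ∣ T ∣
  ∣∣-mono {S} S⊆T = ∣∣-unique (deduplicate-! S) (S⊆T ∘ deduplicate-⊆ S)

  ∣∣-++-≤ : (S T : FinSet n) → ∣ S ++ T ∣ ≤ℕ ∣ S ∣ ℕ.+ ∣ T ∣
  ∣∣-++-≤ S T = subst (∣ S ++ T ∣ ≤ℕ_) (length-++ (deduplicate _≟_ S))
    (length-mono-⊆ (deduplicate-! (S ++ T)) (λ z∈ →
      [ ∈-++⁺ˡ ∘ ⊆-deduplicate S , ∈-++⁺ʳ _ ∘ ⊆-deduplicate T ]′
        (∈-++⁻ S (deduplicate-⊆ (S ++ T) z∈))))

  ∣∣-++-disjoint : (S T : FinSet n) → Disjoint S T → ∣ S ∣ ℕ.+ ∣ T ∣ ≤ℕ ∣ S ++ T ∣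
  ∣∣-++-disjoint S T S#T = subst (_≤ℕ ∣ S ++ T ∣) (length-++ (deduplicate _≟_ S))
    (∣∣-unique
      (Unique.++⁺ (deduplicate-! S) (deduplicate-! T)
        λ (z∈S , z∈T) → S#T (deduplicate-⊆ S z∈S , deduplicate-⊆ T z∈T))
      λ z∈ → [ ∈-++⁺ˡ ∘ deduplicate-⊆ S , ∈-++⁺ʳ S ∘ deduplicate-⊆ T ]′
               (∈-++⁻ (deduplicate _≟_ S) z∈))

  ∣∣-cover : (S T U : FinSet n) → (∀ {x} → x ∈ S → x ∈ T ⊎ x ∈ U) → ∣ S ∣ ≤ℕ ∣ T ∣ ℕ.+ ∣ U ∣
  ∣∣-cover S T U cov =
    ℕ.≤-trans (∣∣-mono ([ ∈-++⁺ˡ , ∈-++⁺ʳ T ]′ ∘ cov)) (∣∣-++-≤ T U)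

  ∈-∩⁻ : ∀ {x} {S T : FinSet n} → x ∈ S ∩ T → x ∈ S × x ∈ T
  ∈-∩⁻ {T = T} = ∈-filter⁻ (_∈? T)

  ∈-∖⁺ : ∀ {x} {S T : FinSet n} → x ∈ S → x ∉ T → x ∈ S ∖ T
  ∈-∖⁺ {T = T} = ∈-filter⁺ (λ x → ¬? (x ∈? T))

  ∈-∖⁻ : ∀ {x} {S T : FinSet n} → x ∈ S ∖ T → x ∈ S × x ∉ T
  ∈-∖⁻ {T = T} = ∈-filter⁻ (λ x → ¬? (x ∈? T))

  ∣∣-filter : ∀ {p} {P : Pred (𝔽₂^ n) p} (P? : Decidable P) (S : FinSet n) →
              ∣ S ∣ ≤ℕ ∣ filter P? S ∣ ℕ.+ ∣ filter (¬? ∘ P?) S ∣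
  ∣∣-filter P? S = ∣∣-cover S (filter P? S) (filter (¬? ∘ P?) S) λ {x} x∈S →
    Sum.map (∈-filter⁺ P? x∈S) (∈-filter⁺ (¬? ∘ P?) x∈S) (toSum (P? x))

  ∣S∣≤∣S∩T∣+∣S∖T∣ : (S T : FinSet n) → ∣ S ∣ ≤ℕ ∣ S ∩ T ∣ ℕ.+ ∣ S ∖ T ∣
  ∣S∣≤∣S∩T∣+∣S∖T∣ S T = ∣∣-filter (_∈? T) S

  -- Both sides count the union of `S` and `T`: the left is a disjoint decomposition, the right a
  -- cover. It is used for the pair `A`, `B` in the density bound and for `B`, `A` in comparing
  -- `∣ B ∣` with `∣ A ∣`.
  ∣S∣+∣T∖S∣≤∣T∣+∣S∖T∣ : (S T : FinSet n) → ∣ S ∣ ℕ.+ ∣ T ∖ S ∣ ≤ℕ ∣ T ∣ ℕ.+ ∣ S ∖ T ∣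
  ∣S∣+∣T∖S∣≤∣T∣+∣S∖T∣ S T = ℕ.≤-trans
    (∣∣-++-disjoint S (T ∖ S) λ (z∈S , z∈T∖S) → proj₂ (∈-∖⁻ {S = T} z∈T∖S) z∈S)
    (∣∣-cover (S ++ T ∖ S) T (S ∖ T) λ {x} z∈ →
      [ (λ x∈S → Sum.map₂ (∈-∖⁺ x∈S) (toSum (x ∈? T)))
      , (λ x∈T∖S → inj₁ (proj₁ (∈-∖⁻ {S = T} x∈T∖S))) ]′ (∈-++⁻ S z∈))

  -- `S △ T` is by definition the concatenation of the two differences, and these are disjoint.
  ∣S∖T∣+∣T∖S∣≤∣S△T∣ : (S T : FinSet n) → ∣ S ∖ T ∣ ℕ.+ ∣ T ∖ S ∣ ≤ℕ ∣ S △ T ∣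
  ∣S∖T∣+∣T∖S∣≤∣S△T∣ S T = ∣∣-++-disjoint (S ∖ T) (T ∖ S)
    λ (z∈S∖T , z∈T∖S) → proj₂ (∈-∖⁻ {S = S} z∈S∖T) (proj₁ (∈-∖⁻ {S = T} z∈T∖S))

  -- Sumsets and covers by cosets

  ⊹⁺ : ∀ {x y} {S T : FinSet n} → x ∈ S → y ∈ T → x ⊕ y ∈ S ⊹ T
  ⊹⁺ = ∈-cartesianProductWith⁺ _⊕_

  ⊹⁻ : ∀ {x} (S T : FinSet n) → x ∈ S ⊹ T → ∃ λ s → ∃ λ t → s ∈ S × t ∈ T × x ≡ s ⊕ t
  ⊹⁻ S T = ∈-cartesianProductWith⁻ _⊕_ S T

  ⊹-mono : {S S′ T T′ : FinSet n} → S ⊆ S′ → T ⊆ T′ → S ⊹ T ⊆ S′ ⊹ T′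
  ⊹-mono {S} {T = T} S⊆S′ T⊆T′ x∈ with _ , _ , s∈ , t∈ , refl ← ⊹⁻ S T x∈ =
    ⊹⁺ (S⊆S′ s∈) (T⊆T′ t∈)

  ⊹-assoc : (S T U : FinSet n) → S ⊹ (T ⊹ U) ⊆ S ⊹ T ⊹ U
  ⊹-assoc S T U x∈
    with s , _ , s∈ , tu∈ , refl ← ⊹⁻ S (T ⊹ U) x∈
    with t , u , t∈ , u∈ , refl ← ⊹⁻ T U tu∈
    = subst (_∈ S ⊹ T ⊹ U) (⊕-assoc s t u) (⊹⁺ (⊹⁺ s∈ t∈) u∈)

  length-⊹ : (S T : FinSet n) → length (S ⊹ T) ≡ length S ℕ.* length T
  length-⊹ []      T = refl
  length-⊹ (s ∷ S) T = trans (length-++ (map (s ⊕_) T))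
    (cong₂ ℕ._+_ (length-map (s ⊕_) T) (length-⊹ S T))

  -- Packing and pigeonhole for the cosets of one subspace.

  module _ (V : Subspace n) where

    -- Differences are sums in characteristic 2, so the entries lie in pairwise distinct cosets.
    -- Repeated entries are excluded as well, since `s ⊕ s` is `𝟎`; hence `length` counts the
    -- cosets.
    Separated : FinSet n → Set
    Separated = AllPairs λ s t → s ⊕ t ∉ elements V

    -- The coset is left unnamed, so the empty set qualifies.
    InCoset : FinSet n → Set
    InCoset Z = ∀ {x y} → x ∈ Z → y ∈ Z → x ⊕ y ∈ elements V

    -- Within one translate of `Z`, cancellation applies. A coincidence between the translates by
    -- `t` and `t′` would put `t ⊕ t′` in `V`, as a sum of two elements of `Z`, against separation.
    ⊹-unique : ∀ {T Z} → Separated T → Unique Z → InCoset Z → Unique (T ⊹ Z)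
    ⊹-unique {[]}        []           Z! Z⊆ = []
    ⊹-unique {t ∷ T} {Z} (t∉T ∷ Tsep) Z! Z⊆ =
      Unique.++⁺ (Unique.map⁺ (⊕-cancelˡ t _ _) Z!) (⊹-unique Tsep Z! Z⊆) disjoint
      where
      disjoint : Disjoint (map (t ⊕_) Z) (T ⊹ Z)
      disjoint (x∈tZ , x∈TZ)
        with z , z∈ , refl ← ∈-map⁻ (t ⊕_) x∈tZ
        with t′ , z′ , t′∈ , z′∈ , eq ← ⊹⁻ T Z x∈TZ
        = All.lookup t∉T t′∈ (subst (_∈ elements V) (sym (⊕-exchange eq)) (Z⊆ z∈ z′∈))

    -- The sums of `T` with a repetition-free copy of `Z` are distinct. This serves twice: to bound
    -- `∣ A ⊹ A ∣` from below, and to see that two cosets of `V` fit into `H`.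
    separated-packing : ∀ {T Z} → Separated T → InCoset Z → length T ℕ.* ∣ Z ∣ ≤ℕ ∣ T ⊹ Z ∣
    separated-packing {T} {Z} Tsep Z⊆ = subst (_≤ℕ ∣ T ⊹ Z ∣) (length-⊹ T (deduplicate _≟_ Z))
      (∣∣-unique (⊹-unique Tsep (deduplicate-! Z) λ x∈ y∈ → Z⊆ (deduplicate-⊆ Z x∈) (deduplicate-⊆ Z y∈))
                 (⊹-mono {T} id (deduplicate-⊆ Z)))

    -- Greedy choice: an element is kept exactly when the cosets of those already kept miss it.
    -- Choosing within `A` is what later keeps the sums inside `A ⊹ A`.
    representatives : ∀ A → ∃ λ R → R ⊆ A × Separated R × Covers V A R
    representatives []      = [] , id , [] , λ ()
    representatives (a ∷ A) with representatives A
    ... | R , R⊆A , Rsep , cov with a ∈? (R ⊹ elements V)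
    ...   | yes a∈ = R , there ∘ R⊆A , Rsep , λ { (here refl) → a∈ ; (there x∈) → cov x∈ }
    ...   | no  a∉ = a ∷ R
                   , (λ { (here refl) → here refl ; (there x∈) → there (R⊆A x∈) })
                   , All.tabulate a∉r+V ∷ Rsep
                   , λ { (here refl) → subst (_∈ (a ∷ R) ⊹ elements V) (⊕-identityʳ a)
                                         (⊹⁺ {S = a ∷ R} (here refl) (Subspace.𝟎-mem V))
                       ; (there x∈) → ∈-++⁺ʳ (map (a ⊕_) (elements V)) (cov x∈) }
      where
      a∉r+V : ∀ {r} → r ∈ R → a ⊕ r ∉ elements V
      a∉r+V {r} r∈ a⊕r∈ = a∉ (subst (_∈ R ⊹ elements V)
        (trans (cong (r ⊕_) (⊕-comm a r)) (x⊕[x⊕y]≡y r a)) (⊹⁺ r∈ a⊕r∈))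

    -- Pigeonhole by induction on `T`: the part of `S` in the coset of `t` is split off and the
    -- other cosets cover the rest. The larger of `S₁` and the inductive `Z₂` is kept, so its size
    -- bounds every term of the count.
    popular-coset : ∀ T {S} → Covers V S T →
                    ∃ λ Z → Z ⊆ S × InCoset Z × ∣ S ∣ ≤ℕ length T ℕ.* ∣ Z ∣
    popular-coset []      {[]}    cov = [] , id , (λ ()) , ℕ.z≤n
    popular-coset []      {s ∷ S} cov with () ← cov (here refl)
    popular-coset (t ∷ T) {S}     cov = choose (popular-coset T S₂-cov)
      where
      In? = λ x → (t ⊕ x) ∈? elements V
      S₁ = filter In? S
      S₂ = filter (¬? ∘ In?) S

      S₂-cov : Covers V S₂ T
      S₂-cov x∈ with x∈S , t⊕x∉ ← ∈-filter⁻ (¬? ∘ In?) {xs = S} x∈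
        with ⊹⁻ (t ∷ T) (elements V) (cov x∈S)
      -- Here the point is `t ⊕ v`, so adding `t` gives back `v`, and the point was filtered out of
      -- `S₂`.
      ... | _ , v , here refl , v∈ , refl =
        contradiction (subst (_∈ elements V) (sym (x⊕[x⊕y]≡y t v)) v∈) t⊕x∉
      ... | _ , _ , there s∈  , v∈ , refl = ⊹⁺ s∈ v∈

      S₁-coset : InCoset S₁
      S₁-coset {x} {y} x∈ y∈ = subst (_∈ elements V)
        (trans (⊕-interchange t x t y) (trans (cong (_⊕ (x ⊕ y)) (⊕-self t)) (⊕-identityˡ _)))
        (Subspace.⊕-closed V (proj₂ (∈-filter⁻ In? {xs = S} x∈)) (proj₂ (∈-filter⁻ In? {xs = S} y∈)))

      ∣S∣≤∣S₁∣+∣S₂∣ : ∣ S ∣ ≤ℕ ∣ S₁ ∣ ℕ.+ ∣ S₂ ∣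
      ∣S∣≤∣S₁∣+∣S₂∣ = ∣∣-filter In? S

      choose : (∃ λ Z → Z ⊆ S₂ × InCoset Z × ∣ S₂ ∣ ≤ℕ length T ℕ.* ∣ Z ∣) →
               ∃ λ Z → Z ⊆ S × InCoset Z × ∣ S ∣ ≤ℕ suc (length T) ℕ.* ∣ Z ∣
      choose (Z₂ , Z₂⊆ , Z₂-coset , ∣S₂∣≤) with ℕ.≤-total ∣ S₁ ∣ ∣ Z₂ ∣
      ... | inj₁ S₁≤Z₂ = Z₂ , proj₁ ∘ ∈-filter⁻ (¬? ∘ In?) ∘ Z₂⊆ , Z₂-coset
        , ℕ.≤-trans ∣S∣≤∣S₁∣+∣S₂∣ (ℕ.+-mono-≤ S₁≤Z₂ ∣S₂∣≤)
      ... | inj₂ Z₂≤S₁ = S₁ , proj₁ ∘ ∈-filter⁻ In? , S₁-coset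
        , ℕ.≤-trans ∣S∣≤∣S₁∣+∣S₂∣
            (ℕ.+-monoʳ-≤ ∣ S₁ ∣ (ℕ.≤-trans ∣S₂∣≤ (ℕ.*-monoʳ-≤ (length T) Z₂≤S₁)))

    -- Lengths multiply exactly under `_⊹_`, which makes `length` the convenient measure of a cover;
    -- repetitions in `T` only weaken the bound.
    𝒩-minimal : ∀ {S T} → Covers V S T → 𝒩 V S ≤ℕ length T
    𝒩-minimal {S} {T} cov =
      ℕ.≤-trans (proj₂ (proj₂ (coveringNumber V S)) T cov) (length-deduplicate _≟_ T)

    𝒩-attained : ∀ S → ∃ λ T → Covers V S T × length T ≡ 𝒩 V S
    𝒩-attained S with proj₁ (proj₂ (coveringNumber V S))
    ... | T , cov , ∣T∣≡ = deduplicate _≟_ T , ⊹-mono (⊆-deduplicate T) id ∘ cov , ∣T∣≡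

  -- Each coset of `H` is covered by `length L` cosets of `V`. The bound `length R ℕ.* length L` for
  -- `𝒩 V A` is multiplied by the pigeonhole bound for `∣ X ∣`, and the factors are regrouped so
  -- that the packing bound for `R ⊹ Z` applies.
  𝒩-sumset : (V H : Subspace n) (L : FinSet n) → elements H ⊆ L ⊹ elements V →
             (A X Y : FinSet n) → X ⊆ A → X ⊆ Y →
             𝒩 V A ℕ.* ∣ X ∣ ≤ℕ length L ℕ.* ∣ A ⊹ A ∣ ℕ.* 𝒩 H Y
  𝒩-sumset V H L H⊆L+V A X Y X⊆A X⊆Y
    with T , Tcov , ∣T∣≡𝒩 ← 𝒩-attained H Y
    -- A cover of `Y` also covers `X`, so the pigeonhole loses only the factor `𝒩 H Y`.
    with Z , Z⊆X , Z-coset , ∣X∣≤ ← popular-coset H T (λ x∈X → Tcov (X⊆Y x∈X))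
    with R , R⊆A , Rsep , Rcov ← representatives H A
    = begin
      𝒩 V A ℕ.* ∣ X ∣                                    ≤⟨ ℕ.*-mono-≤ (𝒩-minimal V {T = R ⊹ L} A⊆R+L+V) ∣X∣≤ ⟩
      length (R ⊹ L) ℕ.* (length T ℕ.* ∣ Z ∣)            ≡⟨ cong₂ (λ k l → k ℕ.* (l ℕ.* ∣ Z ∣)) (length-⊹ R L) ∣T∣≡𝒩 ⟩
      (length R ℕ.* length L) ℕ.* (𝒩 H Y ℕ.* ∣ Z ∣)      ≡⟨ regroup (length R) (length L) (𝒩 H Y) ∣ Z ∣ ⟩
      length L ℕ.* (length R ℕ.* ∣ Z ∣) ℕ.* 𝒩 H Y        ≤⟨ ℕ.*-monoˡ-≤ (𝒩 H Y) (ℕ.*-monoʳ-≤ (length L) ∣R∣∣Z∣≤) ⟩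
      length L ℕ.* ∣ A ⊹ A ∣ ℕ.* 𝒩 H Y                   ∎
    where
    open ℕ.≤-Reasoning
    open import Data.Nat.Solver using (module +-*-Solver)
    open +-*-Solver

    regroup : ∀ r l k z → (r ℕ.* l) ℕ.* (k ℕ.* z) ≡ l ℕ.* (r ℕ.* z) ℕ.* k
    regroup = solve 4 (λ r l k z → (r :* l) :* (k :* z) := l :* (r :* z) :* k) refl

    A⊆R+L+V : Covers V A (R ⊹ L)
    A⊆R+L+V x∈A = ⊹-assoc R L (elements V) (⊹-mono {R} id H⊆L+V (Rcov x∈A))

    ∣R∣∣Z∣≤ : length R ℕ.* ∣ Z ∣ ≤ℕ ∣ A ⊹ A ∣
    ∣R∣∣Z∣≤ = ℕ.≤-trans (separated-packing H Rsep Z-coset) (∣∣-mono (⊹-mono R⊆A (X⊆A ∘ Z⊆X)))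

  -- Spans

  -- The recursion mirrors `linearCombination`, one summand from `𝟎 ∷ v ∷ []` per coefficient; a
  -- dependent family produces repetitions.
  span : ∀ {d} → Vec (𝔽₂^ n) d → FinSet n
  span []      = 𝟎 ∷ []
  span (v ∷ b) = (𝟎 ∷ v ∷ []) ⊹ span b

  scalar∈line : ∀ p (v : 𝔽₂^ n) → p · v ∈ 𝟎 ∷ v ∷ []
  scalar∈line 0ℙ v = here (0·x≡𝟎 v)
  scalar∈line 1ℙ v = there (here (1·x≡x v))

  line⇒scalar : ∀ {v x : 𝔽₂^ n} → x ∈ 𝟎 ∷ v ∷ [] → ∃ λ p → p · v ≡ x
  line⇒scalar {v} (here refl)         = 0ℙ , 0·x≡𝟎 v
  line⇒scalar {v} (there (here refl)) = 1ℙ , 1·x≡x v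

  linearCombination∈span : ∀ {d} c (b : Vec (𝔽₂^ n) d) → linearCombination c b ∈ span b
  linearCombination∈span []      []      = here refl
  linearCombination∈span (p ∷ c) (v ∷ b) = ⊹⁺ (scalar∈line p v) (linearCombination∈span c b)

  span⇒linearCombination : ∀ {d} (b : Vec (𝔽₂^ n) d) {x} → x ∈ span b →
                           ∃ λ c → linearCombination c b ≡ x
  span⇒linearCombination []      (here refl) = [] , refl
  span⇒linearCombination (v ∷ b) x∈
    with _ , _ , y∈ , z∈ , refl ← ⊹⁻ (𝟎 ∷ v ∷ []) (span b) x∈
    = let p , p·v≡y = line⇒scalar y∈ ; c , c·b≡z = span⇒linearCombination b z∈
      in p ∷ c , cong₂ _⊕_ p·v≡y c·b≡z

  𝟎∈span : ∀ {d} (b : Vec (𝔽₂^ n) d) → 𝟎 ∈ span b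
  𝟎∈span []      = here refl
  𝟎∈span (v ∷ b) = subst (_∈ span (v ∷ b)) (⊕-identityˡ 𝟎)
    (⊹⁺ {S = 𝟎 ∷ v ∷ []} (here refl) (𝟎∈span b))

  line-⊕-closed : ∀ {v x y : 𝔽₂^ n} → x ∈ 𝟎 ∷ v ∷ [] → y ∈ 𝟎 ∷ v ∷ [] → x ⊕ y ∈ 𝟎 ∷ v ∷ []
  line-⊕-closed {v} (here refl)         y∈                  = subst (_∈ 𝟎 ∷ v ∷ []) (sym (⊕-identityˡ _)) y∈
  line-⊕-closed {v} (there (here refl)) (here refl)         = there (here (⊕-identityʳ v))
  line-⊕-closed {v} (there (here refl)) (there (here refl)) = here (⊕-self v)

  span-⊕-closed : ∀ {d} (b : Vec (𝔽₂^ n) d) {x y} → x ∈ span b → y ∈ span b → x ⊕ y ∈ span b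
  span-⊕-closed []      (here refl) (here refl) = here (⊕-self 𝟎)
  span-⊕-closed (v ∷ b) x∈ y∈
    with x₁ , x₂ , x₁∈ , x₂∈ , refl ← ⊹⁻ (𝟎 ∷ v ∷ []) (span b) x∈
       | y₁ , y₂ , y₁∈ , y₂∈ , refl ← ⊹⁻ (𝟎 ∷ v ∷ []) (span b) y∈
    = subst (_∈ span (v ∷ b)) (⊕-interchange x₁ y₁ x₂ y₂)
        (⊹⁺ (line-⊕-closed x₁∈ y₁∈) (span-⊕-closed b x₂∈ y₂∈))

  spanned : ∀ {d} → Vec (𝔽₂^ n) d → Subspace n
  spanned b = record
    { elements = span b
    ; 𝟎-mem    = 𝟎∈span b
    ; ⊕-closed = span-⊕-closed b
    ; ·-closed = λ { 0ℙ {x} x∈ → subst (_∈ span b) (sym (0·x≡𝟎 x)) (𝟎∈span b)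
                   ; 1ℙ {x} x∈ → subst (_∈ span b) (sym (1·x≡x x)) x∈ }
    }

  -- Dropping the first basis vector `v` leaves `V` with `H` the disjoint union of `V` and its
  -- translate by `v`. The alternative of size 1 is for the empty basis, where `H` is trivial and
  -- cannot be halved.
  halving : ∀ {d} {b : Vec (𝔽₂^ n) d} {H : Subspace n} → IsBasis H b →
            ∃ λ (V : Subspace n) → elements V ⊆ elements H ×
            (∃ λ L → length L ≡ 2 × elements H ⊆ L ⊹ elements V) ×
            (∣ elements V ∣ ≡ 1 ⊎ 2 ℕ.* ∣ elements V ∣ ≤ℕ ∣ elements H ∣)
  halving {b = []} {H} basis = spanned []
    , (λ { (here refl) → Subspace.𝟎-mem H })
    -- The second `𝟎` is padding, so that `L` has length 2 in both cases.
    , (𝟎 ∷ 𝟎 ∷ [] , refl , λ x∈H → H⊆ (Equivalence.to (spans _) x∈H))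
    , inj₁ refl
    where
    open IsBasis basis
    H⊆ : ∀ {x} → (∃ λ c → linearCombination c [] ≡ x) → x ∈ (𝟎 ∷ 𝟎 ∷ []) ⊹ span []
    H⊆ ([] , refl) = here (sym (⊕-self 𝟎))
  halving {b = v ∷ b} {H} basis = spanned b , V⊆H , (L , refl , H⊆L+V)
    , inj₂ (ℕ.≤-trans (separated-packing (spanned b) ((v∉V All.∷ All.[]) ∷ All.[] ∷ []) (span-⊕-closed b))
                      (∣∣-mono L+V⊆H))
    where
    open IsBasis basis
    L : FinSet n
    L = 𝟎 ∷ v ∷ []

    H⊆L+V : elements H ⊆ L ⊹ span b
    H⊆L+V x∈H with c , refl ← Equivalence.to (spans _) x∈H = linearCombination∈span c (v ∷ b)

    L+V⊆H : L ⊹ span b ⊆ elements H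
    L+V⊆H x∈ = Equivalence.from (spans _) (span⇒linearCombination (v ∷ b) x∈)

    V⊆H : span b ⊆ elements H
    V⊆H {x} x∈V = L+V⊆H (subst (_∈ L ⊹ span b) (⊕-identityˡ x) (⊹⁺ {S = L} (here refl) x∈V))

    -- If `v` were a combination of `b` with coefficients `c`, then `1ℙ ∷ c` would give a vanishing
    -- combination of the basis with nonzero first coefficient.
    v∉V : 𝟎 ⊕ v ∉ span b
    v∉V 𝟎⊕v∈ with c , eq ← span⇒linearCombination b 𝟎⊕v∈ with
      () ← independent (1ℙ ∷ c)
             (trans (cong₂ _⊕_ (1·x≡x v) (trans eq (⊕-identityˡ v))) (⊕-self v))

-- Ordered fields

module OrderedFieldProperties {c ℓ₁ ℓ₂ : Level} (F : OrderedField c ℓ₁ ℓ₂) where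

  open OrderedField F
  open CommutativeRing commutativeRing
    using ( +-comm; +-assoc; +-identityˡ; +-identityʳ; +-congˡ; +-congʳ
          ; -‿inverseˡ; -‿inverseʳ; *-congˡ; *-congʳ; *-comm; *-assoc; *-identityˡ; *-identityʳ
          ; zeroʳ; distribʳ; ring; semiring; commutativeSemiring)
    renaming (refl to ≈-refl; sym to ≈-sym; trans to ≈-trans)
  open IsStrictPartialOrder isStrictPartialOrder using (<-resp-≈)
    renaming (irrefl to <-irrefl; trans to <-trans; asym to <-asym)
  open IsJoinSemilattice isJoinSemilattice using (isPartialOrder; x≤x∨y; y≤x∨y)
  open IsPartialOrder isPartialOrder public using ()
    renaming (refl to ≤-refl; reflexive to ≤-reflexive; trans to ≤-trans)
  open import Algebra.Properties.Ring ring using (-1*x≈-x; -‿involutive)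
  open import Algebra.Properties.Semiring.Mult semiring using (×-homo-+; ×-homo-1; ×1-homo-*)
  open import Algebra.Solver.Ring.NaturalCoefficients.Default commutativeSemiring
    using (solve; _:=_; _:+_; _:*_)

  poset : Poset _ _ _
  poset = record { isPartialOrder = isPartialOrder }

  open import Relation.Binary.Reasoning.PartialOrder poset

  <-resp₂ : ∀ {x x′ y y′} → x ≈ x′ → y ≈ y′ → x < y → x′ < y′
  <-resp₂ x≈x′ y≈y′ = proj₂ <-resp-≈ x≈x′ ∘ proj₁ <-resp-≈ y≈y′

  <⇒≤ : ∀ {x y} → x < y → x ≤ y
  <⇒≤ = <-asym

  x-y+y≈x : ∀ x y → x - y + y ≈ x
  x-y+y≈x x y = ≈-trans (+-assoc x (- y) y) (≈-trans (+-congˡ (-‿inverseˡ y)) (+-identityʳ x))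

  x+y-y≈x : ∀ x y → x + y - y ≈ x
  x+y-y≈x x y = ≈-trans (+-assoc x y (- y)) (≈-trans (+-congˡ (-‿inverseʳ y)) (+-identityʳ x))

  +-monoˡ-≤ : ∀ {x y} z → x ≤ y → x + z ≤ y + z
  +-monoˡ-≤ z x≤y y+z<x+z =
    x≤y (<-resp₂ (x+y-y≈x _ z) (x+y-y≈x _ z) (+-monoˡ-< (- z) y+z<x+z))

  +-mono-≤ : ∀ {x y u v} → x ≤ y → u ≤ v → x + u ≤ y + v
  +-mono-≤ {x} {y} {u} {v} x≤y u≤v = begin
    x + u  ≤⟨ +-monoˡ-≤ u x≤y ⟩
    y + u  ≈⟨ +-comm y u ⟩
    u + y  ≤⟨ +-monoˡ-≤ y u≤v ⟩
    v + y  ≈⟨ +-comm v y ⟩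
    y + v  ∎

  +-cancelʳ-≤ : ∀ {x y} z → x + z ≤ y + z → x ≤ y
  +-cancelʳ-≤ z x+z≤y+z y<x = x+z≤y+z (+-monoˡ-< z y<x)

  -- `1#` is apart from `0#`. If it were negative, `- 1#` would be positive, and hence so would its
  -- square `1#`.
  0<1 : 0# < 1#
  0<1 with HeytingCommutativeRingProperties.1#0 heytingCommutativeRing
    where
    heytingCommutativeRing : HeytingCommutativeRing _ _ _
    heytingCommutativeRing = record
      { isHeytingCommutativeRing = IsHeytingField.isHeytingCommutativeRing isHeytingField }
  ... | inj₂ 0<1 = 0<1
  ... | inj₁ 1<0 = <-resp₂ ≈-refl -1*-1≈1 (*-pos 0<-1 0<-1)
    where
    0<-1 : 0# < - 1#
    0<-1 = <-resp₂ (-‿inverseʳ 1#) (+-identityˡ (- 1#)) (+-monoˡ-< (- 1#) 1<0)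
    -1*-1≈1 : - 1# * - 1# ≈ 1#
    -1*-1≈1 = ≈-trans (-1*x≈-x (- 1#)) (-‿involutive 1#)

  *-monoˡ-< : ∀ {x y z} → 0# < z → x < y → x * z < y * z
  *-monoˡ-< {x} {y} {z} 0<z x<y = <-resp₂ (+-identityˡ _)
    (≈-trans (≈-sym (distribʳ z (y - x) x)) (*-congʳ (x-y+y≈x y x)))
    (+-monoˡ-< (x * z) (*-pos (<-resp₂ (-‿inverseʳ x) ≈-refl (+-monoˡ-< (- x) x<y)) 0<z))

  *-cancelʳ-≤ : ∀ {x y z} → 0# < z → x * z ≤ y * z → x ≤ y
  *-cancelʳ-≤ 0<z xz≤yz y<x = xz≤yz (*-monoˡ-< 0<z y<x)

  ≮∧≯⇒≈ : ∀ {x y} → ¬ x < y → ¬ y < x → x ≈ y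
  ≮∧≯⇒≈ x≮y y≮x = proj₁ (tight _ _) [ x≮y , y≮x ]′

  -- The conclusion is a negation, so x < y or x ≈ y, and 0 < z or 0 ≈ z, may
  -- be assumed even though the order is not decidable.
  *-monoˡ-≤ : ∀ {x y z} → 0# ≤ z → x ≤ y → x * z ≤ y * z
  *-monoˡ-≤ {x} {y} {z} 0≤z x≤y yz<xz = <-irrefl (*-congʳ (≮∧≯⇒≈ x≤y x≮y)) yz<xz
    where
    x≮y : ¬ x < y
    x≮y x<y = <-irrefl (≈-trans (zero-product y) (≈-sym (zero-product x))) yz<xz
      where
      z≈0 : z ≈ 0#
      z≈0 = ≮∧≯⇒≈ 0≤z λ 0<z → <-asym (*-monoˡ-< 0<z x<y) yz<xz
      zero-product : ∀ t → t * z ≈ 0#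
      zero-product t = ≈-trans (*-congˡ z≈0) (zeroʳ t)

  *-monoʳ-≤ : ∀ {x y z} → 0# ≤ z → x ≤ y → z * x ≤ z * y
  *-monoʳ-≤ {x} {y} {z} 0≤z x≤y = begin
    z * x  ≈⟨ *-comm z x ⟩
    x * z  ≤⟨ *-monoˡ-≤ 0≤z x≤y ⟩
    y * z  ≈⟨ *-comm y z ⟩
    z * y  ∎

  ≤-/ : ∀ {x y z} (0<z : 0# < z) → x * z ≤ y → x ≤ y / z ⟨ 0<z ⟩
  ≤-/ {x} {y} {z} 0<z xz≤y with #⇒invertible (inj₂ 0<z)
  ... | z⁻¹ , z⁻¹z≈1 , _ = *-cancelʳ-≤ 0<z (begin
    x * z          ≤⟨ xz≤y ⟩
    y              ≈⟨ *-identityʳ y ⟨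
    y * 1#         ≈⟨ *-congˡ z⁻¹z≈1 ⟨
    -- The apartness of `z` from `0#` yields an inverse of `z - 0#`, which is rewritten to `z`.
    y * (z⁻¹ * (z - 0#)) ≈⟨ *-congˡ (*-congˡ (≈-trans (≈-sym (+-identityʳ _)) (x-y+y≈x z 0#))) ⟩
    y * (z⁻¹ * z)  ≈⟨ *-assoc y z⁻¹ z ⟨
    y * z⁻¹ * z    ∎)

  -- The natural numbers inside the field.

  fromℕ-homo-+ : ∀ m n → fromℕ (m ℕ.+ n) ≈ fromℕ m + fromℕ n
  fromℕ-homo-+ = ×-homo-+ 1#

  fromℕ-homo-* : ∀ m n → fromℕ (m ℕ.* n) ≈ fromℕ m * fromℕ n
  fromℕ-homo-* = ×1-homo-*

  fromℕ-nonNeg : ∀ n → 0# ≤ fromℕ n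
  fromℕ-nonNeg zero    = ≤-refl
  fromℕ-nonNeg (suc n) = begin
    0#            ≈⟨ +-identityˡ 0# ⟨
    0# + 0#       ≤⟨ +-mono-≤ (<⇒≤ 0<1) (fromℕ-nonNeg n) ⟩
    1# + fromℕ n  ∎

  fromℕ-mono-≤ : ∀ {m n} → m ≤ℕ n → fromℕ m ≤ fromℕ n
  fromℕ-mono-≤ {n = n} ℕ.z≤n       = fromℕ-nonNeg n
  fromℕ-mono-≤         (ℕ.s≤s m≤n) = +-mono-≤ ≤-refl (fromℕ-mono-≤ m≤n)

  fromℕ-pos : ∀ {n} → 0 ℕ.< n → 0# < fromℕ n
  fromℕ-pos {suc zero}    _ = <-resp₂ ≈-refl (≈-sym (×-homo-1 1#)) 0<1
  fromℕ-pos {suc (suc n)} _ = <-trans (fromℕ-pos {suc n} ℕ.z<s)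
    (<-resp₂ (+-identityˡ _) ≈-refl (+-monoˡ-< (fromℕ (suc n)) 0<1))

  fromℕ-≤-+ : ∀ m p q → m ≤ℕ p ℕ.+ q → fromℕ m ≤ fromℕ p + fromℕ q
  fromℕ-≤-+ m p q m≤p+q =
    ≤-trans (fromℕ-mono-≤ m≤p+q) (≤-reflexive (fromℕ-homo-+ p q))

  fromℕ-+-≤ : ∀ m p q → p ℕ.+ q ≤ℕ m → fromℕ p + fromℕ q ≤ fromℕ m
  fromℕ-+-≤ m p q p+q≤m =
    ≤-trans (≤-reflexive (≈-sym (fromℕ-homo-+ p q))) (fromℕ-mono-≤ p+q≤m)

  fromℕ-+-mono-≤ : ∀ m n p q → m ℕ.+ n ≤ℕ p ℕ.+ q → fromℕ m + fromℕ n ≤ fromℕ p + fromℕ q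
  fromℕ-+-mono-≤ m n p q m+n≤p+q =
    ≤-trans (fromℕ-+-≤ (p ℕ.+ q) m n m+n≤p+q) (≤-reflexive (fromℕ-homo-+ p q))

  fromℕ-*-≤-2* : ∀ m n p q → m ℕ.* n ≤ℕ 2 ℕ.* p ℕ.* q →
                 fromℕ m * fromℕ n ≤ (1# + 1#) * fromℕ p * fromℕ q
  fromℕ-*-≤-2* m n p q mn≤2pq = begin
    fromℕ m * fromℕ n              ≈⟨ fromℕ-homo-* m n ⟨
    fromℕ (m ℕ.* n)                ≤⟨ fromℕ-mono-≤ mn≤2pq ⟩
    fromℕ (2 ℕ.* p ℕ.* q)          ≈⟨ fromℕ-homo-* (2 ℕ.* p) q ⟩
    fromℕ (2 ℕ.* p) * fromℕ q      ≈⟨ *-congʳ (fromℕ-homo-* 2 p) ⟩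
    fromℕ 2 * fromℕ p * fromℕ q    ≈⟨ *-congʳ (*-congʳ (+-congˡ (+-identityʳ 1#))) ⟩
    (1# + 1#) * fromℕ p * fromℕ q  ∎

  -- The strict inequality is obtained in `ℕ`, where the order is decidable: `n ≤ℕ m` would make
  -- `fromℕ n` at most `η * fromℕ n`, which is strictly smaller.
  fraction⇒< : ∀ {η} {m n} → 0 ℕ.< n → η < 1# → fromℕ m ≤ η * fromℕ n → m ℕ.< n
  fraction⇒< {η} {m} {n} 0<n η<1 m≤ηn = ℕ.≰⇒> λ n≤m →
    ≤-trans (fromℕ-mono-≤ n≤m) m≤ηn (<-resp₂ ≈-refl (*-identityˡ _) (*-monoˡ-< (fromℕ-pos 0<n) η<1))

  -- In the application a, b, u, w, x and y are the cardinalities of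
  -- A, B, A ∖ B, B ∖ A, Y ∩ A and Y.
  Δ-density : ∀ {γ η a b u w x y} → 0# ≤ γ → 0# ≤ u → 0# ≤ w →
              a + w ≤ b + u → u + w ≤ η * a → γ * b ≤ y → y ≤ x + w →
              Δ γ η * a ≤ x
  Δ-density {γ} {η} {a} {b} {u} {w} {x} {y} 0≤γ 0≤u 0≤w a+w≤b+u u+w≤ηa γb≤y y≤x+w =
    -- Adding `m * η * a + w` clears the negative term of `Δ γ η` and leaves `γ * a + w` on the
    -- left.
    +-cancelʳ-≤ (m * η * a + w) (begin
      Δ γ η * a + (m * η * a + w)        ≈⟨ solve 4 (λ d e a w → d :* a :+ (e :* a :+ w) := (d :+ e) :* a :+ w)
                                              ≈-refl (Δ γ η) (m * η) a w ⟩
      (Δ γ η + m * η) * a + w            ≈⟨ +-congʳ (*-congʳ (x-y+y≈x γ (m * η))) ⟩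
      γ * a + w                          ≈⟨ +-congˡ (≈-trans (*-congʳ (x-y+y≈x 1# γ)) (*-identityˡ w)) ⟨
      -- Splitting `w` into its `γ` and `1# - γ` parts lets `γ` multiply `a + w`. What remains is
      -- `γ * u` and `(1# - γ) * w`, whose coefficients are both at most the maximum `m`.
      γ * a + (1# - γ + γ) * w           ≈⟨ solve 4 (λ g d a w → g :* a :+ (d :+ g) :* w := g :* (a :+ w) :+ d :* w)
                                              ≈-refl γ (1# - γ) a w ⟩
      γ * (a + w) + (1# - γ) * w         ≤⟨ +-mono-≤ (*-monoʳ-≤ 0≤γ a+w≤b+u) (*-monoˡ-≤ 0≤w (y≤x∨y γ (1# - γ))) ⟩
      γ * (b + u) + m * w                ≈⟨ solve 5 (λ g b u m w → g :* (b :+ u) :+ m :* w := g :* b :+ (g :* u :+ m :* w))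
                                              ≈-refl γ b u m w ⟩
      γ * b + (γ * u + m * w)            ≤⟨ +-mono-≤ (≤-trans γb≤y y≤x+w)
                                              (+-monoˡ-≤ (m * w) (*-monoˡ-≤ 0≤u (x≤x∨y γ (1# - γ)))) ⟩
      x + w + (m * u + m * w)            ≈⟨ solve 4 (λ x w m u → x :+ w :+ (m :* u :+ m :* w) := x :+ w :+ m :* (u :+ w))
                                              ≈-refl x w m u ⟩
      x + w + m * (u + w)                ≤⟨ +-mono-≤ ≤-refl (*-monoʳ-≤ (≤-trans 0≤γ (x≤x∨y γ (1# - γ))) u+w≤ηa) ⟩
      x + w + m * (η * a)                ≈⟨ solve 5 (λ x w m e a → x :+ w :+ m :* (e :* a) := x :+ (m :* e :* a :+ w))
                                              ≈-refl x w m η a ⟩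
      x + (m * η * a + w)                ∎)
    where m = γ ⊔ (1# - γ)

  -- Here `t`, `s`, `N`, `x` stand for `𝒩 V A`, `∣ A ⊹ A ∣`, `𝒩 H Y`, `∣ X ∣`, and `D` for `Δ γ η`.
  -- Multiplying through by `D` and by `a` turns the quotient bound into a chain of products.
  covering-quotient : ∀ {a D K N P s t x} → 0# < a → (0<D : 0# < D) → 0# ≤ t → 0# ≤ s → 0# ≤ N →
                      D * a ≤ x → t * x ≤ (1# + 1#) * s * N → s ≤ K * a → N ≤ P →
                      t ≤ ((1# + 1#) * K * P) / D ⟨ 0<D ⟩
  covering-quotient {a} {D} {K} {N} {P} {s} {t} {x} 0<a 0<D 0≤t 0≤s 0≤N Da≤x tx≤2sN s≤Ka N≤P =
    ≤-/ 0<D (*-cancelʳ-≤ 0<a (begin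
      t * D * a                ≈⟨ *-assoc t D a ⟩
      t * (D * a)              ≤⟨ *-monoʳ-≤ 0≤t Da≤x ⟩
      t * x                    ≤⟨ tx≤2sN ⟩
      (1# + 1#) * s * N        ≈⟨ *-assoc (1# + 1#) s N ⟩
      -- `N` is replaced first, against the nonnegative `s`; then `s` is replaced against `P`, which
      -- is nonnegative because `N` is.
      (1# + 1#) * (s * N)      ≤⟨ *-monoʳ-≤ 0≤2 (*-monoʳ-≤ 0≤s N≤P) ⟩
      (1# + 1#) * (s * P)      ≤⟨ *-monoʳ-≤ 0≤2 (*-monoˡ-≤ (≤-trans 0≤N N≤P) s≤Ka) ⟩
      (1# + 1#) * (K * a * P)  ≈⟨ solve 4 (λ T K a P → T :* (K :* a :* P) := T :* K :* P :* a)
                                    ≈-refl (1# + 1#) K a P ⟩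
      (1# + 1#) * K * P * a    ∎))
    where
    0≤2 : 0# ≤ 1# + 1#
    0≤2 = ≤-trans (<⇒≤ 0<1) (≤-trans (≤-reflexive (≈-sym (+-identityʳ 1#))) (+-mono-≤ ≤-refl (<⇒≤ 0<1)))

-- Size and covering bounds for the halved subspace.

nonempty⇒0<∣∣ : ∀ {n} {S : FinSet n} → S ≢ [] → 0 ℕ.< ∣ S ∣
nonempty⇒0<∣∣ {S = []}    S≢[] = contradiction refl S≢[]
nonempty⇒0<∣∣ {S = _ ∷ _} S≢[] = ℕ.z<s

theorem6p3 : ∀ {c ℓ₁ ℓ₂ : Level} (F : OrderedField c ℓ₁ ℓ₂) →
    let open OrderedField F in
    ∀ (n : ℕ) (B Y : FinSet n) (H : Subspace n)
    (d : ℕ) (b : Vec (𝔽₂^ n) d) → IsBasis H b →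
    ∀ (K γ P : Carrier) →
    Y ⊆ B →
    0# < γ → γ ≤ 1# →
    γ * fromℕ ∣ B ∣ ≤ fromℕ ∣ Y ∣ →
    ∣ elements H ∣ ≤ℕ ∣ Y ∣ →
    fromℕ (𝒩 H Y) ≤ P →
    Σ (Subspace n) λ V →
    elements V ⊆ elements H ×
    (∀ (A : FinSet n) (η : Carrier) →
    A ≢ [] →
    fromℕ ∣ A ⊹ A ∣ ≤ K * fromℕ ∣ A ∣ →
    0# ≤ η → η < 1# →
    fromℕ ∣ A △ B ∣ ≤ η * fromℕ ∣ A ∣ →
    (Δ>0 : 0# < Δ γ η) →
    ∣ elements V ∣ ≤ℕ ∣ A ∣ ×
    fromℕ (𝒩 V A) ≤ ((1# + 1#) * K * P) / (Δ γ η) ⟨ Δ>0 ⟩)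
theorem6p3 F n B Y H d b basis K γ P Y⊆B 0<γ _ γB≤Y ∣H∣≤∣Y∣ 𝒩≤P
  -- `V` is fixed before `A` and `η` are bound, so it cannot depend on them.
  with V , V⊆H , (L , ∣L∣≡2 , H⊆L+V) , ∣V∣-bound ← halving basis
  = V , V⊆H , λ A η A≢[] A+A≤KA _ η<1 A△B≤ηA Δ>0 →
    let
      X = Y ∩ A
      0<∣A∣ = nonempty⇒0<∣∣ A≢[]

      ∣Y∣≤∣X∣+∣B∖A∣ : ∣ Y ∣ ≤ℕ ∣ X ∣ ℕ.+ ∣ B ∖ A ∣
      ∣Y∣≤∣X∣+∣B∖A∣ = ℕ.≤-trans (∣S∣≤∣S∩T∣+∣S∖T∣ Y A)
        -- As `Y ⊆ B`, the points of `Y` outside `A` lie in `B` outside `A`.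
        (ℕ.+-monoʳ-≤ ∣ X ∣ (∣∣-mono (λ x∈ → ∈-∖⁺ (Y⊆B (proj₁ (∈-∖⁻ {S = Y} x∈))) (proj₂ (∈-∖⁻ {S = Y} x∈)))))

      ∣B∖A∣<∣A∣ : ∣ B ∖ A ∣ ℕ.< ∣ A ∣
      ∣B∖A∣<∣A∣ = fraction⇒< 0<∣A∣ η<1 (≤-trans
        (fromℕ-mono-≤ (ℕ.≤-trans (ℕ.m≤n+m _ ∣ A ∖ B ∣) (∣S∖T∣+∣T∖S∣≤∣S△T∣ A B))) A△B≤ηA)

      ∣B∣<2∣A∣ : ∣ B ∣ ℕ.< 2 ℕ.* ∣ A ∣
      ∣B∣<2∣A∣ = ℕ.≤-<-trans
        (ℕ.≤-trans (ℕ.m≤m+n _ ∣ A ∖ B ∣) (∣S∣+∣T∖S∣≤∣T∣+∣S∖T∣ B A))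
        -- `2 ℕ.* ∣ A ∣` unfolds to `∣ A ∣ ℕ.+ (∣ A ∣ ℕ.+ 0)`, hence the identity law.
        (ℕ.+-monoʳ-< ∣ A ∣ (subst (∣ B ∖ A ∣ ℕ.<_) (sym (ℕ.+-identityʳ ∣ A ∣)) ∣B∖A∣<∣A∣))

      ΔA≤X : Δ γ η * fromℕ ∣ A ∣ ≤ fromℕ ∣ X ∣
      ΔA≤X = Δ-density (<⇒≤ 0<γ) (fromℕ-nonNeg ∣ A ∖ B ∣) (fromℕ-nonNeg ∣ B ∖ A ∣)
        (fromℕ-+-mono-≤ (∣ A ∣) (∣ B ∖ A ∣) (∣ B ∣) (∣ A ∖ B ∣) (∣S∣+∣T∖S∣≤∣T∣+∣S∖T∣ A B))
        (≤-trans (fromℕ-+-≤ (∣ A △ B ∣) (∣ A ∖ B ∣) (∣ B ∖ A ∣) (∣S∖T∣+∣T∖S∣≤∣S△T∣ A B)) A△B≤ηA)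
        γB≤Y (fromℕ-≤-+ (∣ Y ∣) (∣ X ∣) (∣ B ∖ A ∣) ∣Y∣≤∣X∣+∣B∖A∣)
    in
      -- When `V` has one element, nonemptiness of `A` suffices; otherwise the factor 2 cancels from
      -- the chain through `H`, `Y` and `B`.
      [ (λ ∣V∣≡1 → subst (_≤ℕ ∣ A ∣) (sym ∣V∣≡1) 0<∣A∣)
      , (λ 2∣V∣≤∣H∣ → ℕ.<⇒≤ (ℕ.*-cancelˡ-< 2 _ _
           (ℕ.≤-<-trans 2∣V∣≤∣H∣ (ℕ.≤-<-trans (ℕ.≤-trans ∣H∣≤∣Y∣ (∣∣-mono Y⊆B)) ∣B∣<2∣A∣)))) ]′ ∣V∣-bound
    , covering-quotient (fromℕ-pos 0<∣A∣) Δ>0 (fromℕ-nonNeg (𝒩 V A)) (fromℕ-nonNeg ∣ A ⊹ A ∣)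
        (fromℕ-nonNeg (𝒩 H Y)) ΔA≤X
        (fromℕ-*-≤-2* (𝒩 V A) (∣ X ∣) (∣ A ⊹ A ∣) (𝒩 H Y)
          (subst (λ k → 𝒩 V A ℕ.* ∣ X ∣ ≤ℕ k ℕ.* ∣ A ⊹ A ∣ ℕ.* 𝒩 H Y) ∣L∣≡2
            (𝒩-sumset V H L H⊆L+V A X Y
              (λ x∈ → proj₂ (∈-∩⁻ {S = Y} x∈)) (λ x∈ → proj₁ (∈-∩⁻ {S = Y} x∈)))))
        A+A≤KA 𝒩≤P
  where
  open OrderedField F
  open OrderedFieldProperties F
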